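{- Consider words over the alphabet $\{0,1\}$. (1) For every integer $n \equiv 0 \pmod 4$ with $n \geq 8$, there are exactly $n-2$ minimal forbidden words of length $n$, and they are the following words together with their binary complements: - $0^{2i-1}\,1^{n-4i+1}\,0^{2i-1}\,1$ for $1 \leq i \leq n/4 - 1$; - $0\,1^{2i-1}\,0^{n-4i+1}\,1^{2i-1}$ for $1 \leq i \leq n/4 - 1$; - $0\,1^{n-2}\,0$. (2) For every integer $n \equiv 2 \pmod 4$ with $n \geq 10$, there are exactly $n$ minimal forbidden words of length $n$, and they are the following words together with their binary complements: - $0^{2i-1}\,1^{n-4i+1}\,0^{2i-1}\,1$ for $1 \leq i \leq (n-2)/4$; - $0\,1^{2i-1}\,0^{n-4i+1}\,1^{2i-1}$ for $1 \leq i \leq (n-2)/4$; - $0\,1^{n-2}\,0$.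
   Context: Two finite words $x, x'$ are conjugates if there exist (possibly empty) words $u, v$ with $x = uv$ and $x' = vu$. A finite nonempty word $w$ is a mesosome if it is of the form $w = xx'$ where $x'$ is a conjugate of $x$ and $x \neq x'$. A word is minimal forbidden if it is a mesosome but no proper subword of it is a mesosome, where a subword (factor) means a contiguous sub-block. The binary complement of a word over $\{0,1\}$ is obtained by replacing each $0$ by $1$ and each $1$ by $0$. -}

module Defs where

open import Data.Bool.Base using (Bool; true; false; not)
open import Data.List.Base using (List; []; [_]; _++_; length; map; replicate)
open import Data.List.Membership.Propositional using (_∈_)
open import Data.List.Relation.Binary.Infix.Heterogeneous using (Infix)
open import Data.List.Relation.Unary.Unique.Propositional using (Unique)
open import Data.Nat.Base using (ℕ; _+_; _*_; _∸_; _≤_)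
open import Data.Product.Base using (_×_; ∃-syntax)
open import Data.Sum.Base using (_⊎_)
open import Function.Bundles using (_⇔_)
open import Level using (Level; _⊔_)
open import Relation.Binary.PropositionalEquality.Core using (_≡_; _≢_)
open import Relation.Nullary.Negation.Core using (¬_)

private
  variable
    a p : Level

module _ {A : Set a} where

  Conjugate : List A → List A → Set a
  Conjugate x x′ = ∃[ u ] ∃[ v ] (x ≡ u ++ v × x′ ≡ v ++ u)

  Mesosome : List A → Set a
  Mesosome w =
    w ≢ [] × ∃[ x ] ∃[ x′ ] (w ≡ x ++ x′ × Conjugate x x′ × x ≢ x′)

  ProperSubword : List A → List A → Set a
  ProperSubword s w = Infix _≡_ s w × s ≢ w

  MinimalForbidden : List A → Set a
  MinimalForbidden w =
    Mesosome w × (∀ s → ProperSubword s w → ¬ Mesosome s)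

HasExactly : {A : Set a} → ℕ → (A → Set p) → Set (a ⊔ p)
HasExactly k P =
  ∃[ xs ] (length xs ≡ k × Unique xs × (∀ x → x ∈ xs ⇔ P x))

Word : Set
Word = List Bool

pattern 𝟎 = false
pattern 𝟏 = true

complement : Word → Word
complement = map not

MinimalForbiddenOfLength : ℕ → Word → Set
MinimalForbiddenOfLength n w = MinimalForbidden w × length w ≡ n

infix 8 _^_

_^_ : Bool → ℕ → Word
c ^ k = replicate k c

-- The exponent n - 4i + 1 is written (n ∸ 4 * i) + 1. In Listed n m, the bound
-- m on i is intended to satisfy 4 * m ≤ n, so that no subtraction truncates.

word₁ : ℕ → ℕ → Word
word₁ n i =
  𝟎 ^ (2 * i ∸ 1) ++ 𝟏 ^ ((n ∸ 4 * i) + 1) ++ 𝟎 ^ (2 * i ∸ 1) ++ [ 𝟏 ]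

word₂ : ℕ → ℕ → Word
word₂ n i =
  [ 𝟎 ] ++ 𝟏 ^ (2 * i ∸ 1) ++ 𝟎 ^ ((n ∸ 4 * i) + 1) ++ 𝟏 ^ (2 * i ∸ 1)

word₃ : ℕ → Word
word₃ n = [ 𝟎 ] ++ 𝟏 ^ (n ∸ 2) ++ [ 𝟎 ]

Listed : (n m : ℕ) → Word → Set
Listed n m w =
    (∃[ i ] (1 ≤ i × i ≤ m × w ≡ word₁ n i))
  ⊎ (∃[ i ] (1 ≤ i × i ≤ m × w ≡ word₂ n i))
  ⊎ w ≡ word₃ n

WithComplements : (Word → Set) → Word → Set
WithComplements P w = P w ⊎ ∃[ v ] (P v × w ≡ complement v)

{-# OPTIONS --safe #-}
module Submission where

open import Defs
open import Data.Bool.Base using (Bool; not)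
open import Data.Bool.Properties using (_≟_; ¬-not; not-¬)
open import Data.Empty using (⊥)
open import Data.List.Base
  using (List; []; _∷_; _++_; length; map; replicate; filter; upTo; cartesianProductWith)
open import Data.List.Membership.Propositional using (_∈_)
open import Data.List.Membership.Propositional.Properties
  using (∈-map⁺; ∈-map⁻; ∈-++⁺ˡ; ∈-++⁺ʳ; ∈-++⁻; ∈-upTo⁺; ∈-upTo⁻;
         ∈-cartesianProductWith⁺; ∈-cartesianProductWith⁻)
open import Data.List.Properties
open import Data.List.Relation.Binary.Infix.Heterogeneous using (Infix; here; there)
open import Data.List.Relation.Binary.Pointwise as Pointwise using ()
open import Data.List.Relation.Binary.Prefix.Heterogeneous as Prefix using (Prefix; []; _∷_)
open import Data.List.Relation.Unary.All as All using (All; []; _∷_)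
import Data.List.Relation.Unary.All.Properties as All
open import Data.List.Relation.Unary.AllPairs using ([]; _∷_)
open import Data.List.Relation.Unary.Any using (here; there)
open import Data.List.Relation.Unary.Unique.Propositional using (Unique)
import Data.List.Relation.Unary.Unique.Propositional.Properties as Unique
open import Data.Nat.Base using (ℕ; zero; suc; _+_; _*_; _∸_; _≤_; _<_; z≤n; s≤s; ⌊_/2⌋)
open import Data.Nat.DivMod using (_/_; _%_; m≡m%n+[m/n]*n; m*n/n≡m)
open import Data.Nat.ListAction using (sum)
open import Data.Nat.Properties hiding (_≟_)
open import Data.Nat.Tactic.RingSolver using (solve-∀)
open import Data.Product.Base using (_×_; _,_; ∃-syntax)
open import Data.Sum.Base using (_⊎_; inj₁; inj₂)
open import Function.Base using (_∘_)
open import Function.Bundles using (_⇔_; mk⇔)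
open import Relation.Binary.PropositionalEquality
open import Relation.Nullary.Decidable.Core using (yes; no)
open import Relation.Nullary.Negation.Core using (¬_; contradiction)

-- Write a word by its run lengths. Excluding the listed words (of every length)
-- and the two short words 001010 and 010100, for either choice of letters, as
-- factors leaves very few possibilities: interior runs are odd, and as soon as
-- there are five runs all runs have length one. In each remaining case, comparing
-- the occurrences of a letter in the word with those in its first half shows that
-- the word is not a mesosome, unless its halves are equal. So every mesosome has an
-- excluded factor, and a minimal forbidden word of length at least 8 is a listed
-- word. Conversely, the proper factors of a listed word are among the remaining
-- cases, so listed words are minimal.

private
  variable
    p q : Bool
    s w x y : Word

-- Parity and means.

odd : ℕ → ℕ
odd k = suc (k + k)

data Parity : ℕ → Set where
  isEven : ∀ k → Parity (k + k)
  isOdd  : ∀ k → Parity (odd k)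

parity : ∀ n → Parity n
parity zero = isEven 0
parity (suc n) with parity n
... | isEven k = isOdd k
... | isOdd  k = subst Parity (cong suc (+-suc k k)) (isEven (suc k))

odd≢even : ∀ i k → odd i ≢ k + k
odd≢even i       (suc k) eq = odd≢even k i (trans (sym (+-suc k k)) (sym (suc-injective eq)))

-- Here `k` is the mean of `m` and `n`, so the two lie weakly on opposite sides of it.
m+n≡k+k∧k≤m⇒n≤m : ∀ {m n k} → m + n ≡ k + k → k ≤ m → n ≤ m
m+n≡k+k∧k≤m⇒n≤m {m} {n} eq k≤m =
  +-cancelˡ-≤ m n m (≤-trans (≤-reflexive eq) (+-mono-≤ k≤m k≤m))

m+n≡k+k∧m≤k⇒m≤n : ∀ {m n k} → m + n ≡ k + k → m ≤ k → m ≤ n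
m+n≡k+k∧m≤k⇒m≤n {m} {n} eq m≤k =
  +-cancelˡ-≤ m m n (≤-trans (+-mono-≤ m≤k m≤k) (≤-reflexive (sym eq)))

-- Words as run lengths, and their prefixes.

-- Runs of length zero are allowed, so that degenerate shapes need no separate treatment; the
-- encoding becomes unique only for positive lengths, in `runs-injective`.
runs : Bool → Bool → List ℕ → Word
runs p q []       = []
runs p q (k ∷ ks) = p ^ k ++ runs q p ks

infix 4 _⊑_

-- These are the run lengths of prefixes: whole runs, then a last run cut short. The empty prefix is
-- a cut to length zero.
data _⊑_ : List ℕ → List ℕ → Set where
  cut  : ∀ {j k ks} → j ≤ k → j ∷ [] ⊑ k ∷ ks
  keep : ∀ {k js ks} → js ⊑ ks → k ∷ js ⊑ k ∷ ks

replicate-prefix⁻ : ∀ k → Prefix _≡_ s (p ^ k ++ w) →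
  (∃[ j ] (j ≤ k × s ≡ p ^ j)) ⊎ (∃[ t ] (s ≡ p ^ k ++ t × Prefix _≡_ t w))
replicate-prefix⁻ zero    pre           = inj₂ (_ , refl , pre)
replicate-prefix⁻ (suc k) []            = inj₁ (0 , z≤n , refl)
replicate-prefix⁻ (suc k) (refl ∷ pre) with replicate-prefix⁻ k pre
... | inj₁ (j , j≤k , refl)  = inj₁ (suc j , s≤s j≤k , refl)
... | inj₂ (t , refl , pre′) = inj₂ (t , refl , pre′)

runs-prefix⁻ : ∀ k ks → Prefix _≡_ s (runs p q (k ∷ ks)) →
  ∃[ js ] (js ⊑ k ∷ ks × s ≡ runs p q js)
runs-prefix⁻ k ks pre with replicate-prefix⁻ k pre
runs-prefix⁻ k ks pre | inj₁ (j , j≤k , refl) = _ , cut j≤k , sym (++-identityʳ _)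
runs-prefix⁻ k []       pre | inj₂ (_ , refl , [])   = _ , cut ≤-refl , refl
runs-prefix⁻ k (l ∷ ks) pre | inj₂ (_ , refl , pre′) with runs-prefix⁻ l ks pre′
... | _ , js⊑ks , refl = _ , keep js⊑ks , refl

replicate-prefix⁺ : ∀ {j k} → j ≤ k → Prefix _≡_ (p ^ j ++ []) (p ^ k ++ w)
replicate-prefix⁺ z≤n       = []
replicate-prefix⁺ (s≤s j≤k) = refl ∷ replicate-prefix⁺ j≤k

runs-prefix⁺ : ∀ {js ks} → js ⊑ ks → Prefix _≡_ (runs p q js) (runs p q ks)
runs-prefix⁺ (cut j≤k)    = replicate-prefix⁺ j≤k
runs-prefix⁺ (keep {k} js⊑ks) = prepend k (runs-prefix⁺ js⊑ks)
  where
  prepend : ∀ k → Prefix _≡_ s w → Prefix _≡_ (p ^ k ++ s) (p ^ k ++ w)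
  prepend zero    pre = pre
  prepend (suc k) pre = refl ∷ prepend k pre

-- Letter counts and the halves of a mesosome.

occ : Bool → Word → ℕ
occ c = length ∘ filter (c ≟_)

occ-++ : ∀ c x y → occ c (x ++ y) ≡ occ c x + occ c y
occ-++ c x y = trans (cong length (filter-++ (c ≟_) x y)) (length-++ (filter (c ≟_) x))

occ-++-comm : ∀ c x y → occ c (x ++ y) ≡ occ c (y ++ x)
occ-++-comm c x y = trans (occ-++ c x y) (trans (+-comm (occ c x) _) (sym (occ-++ c y x)))

occ-replicate : ∀ c k → occ c (c ^ k) ≡ k
occ-replicate c k =
  trans (cong length (filter-all (c ≟_) (All.replicate⁺ k refl))) (length-replicate k)

occ-replicate-≢ : ∀ k → p ≢ q → occ p (q ^ k) ≡ 0
occ-replicate-≢ {p} k p≢q = cong length (filter-none (p ≟_) (All.replicate⁺ k p≢q))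

-- Odd and even refer to positions counted from one, not to the lengths.
sumOdd sumEven : List ℕ → ℕ
sumOdd  []       = 0
sumOdd  (k ∷ ks) = k + sumEven ks
sumEven []       = 0
sumEven (k ∷ ks) = sumOdd ks

occ-first  : p ≢ q → ∀ ks → occ p (runs p q ks) ≡ sumOdd ks
occ-second : p ≢ q → ∀ ks → occ q (runs p q ks) ≡ sumEven ks
occ-first p≢q [] = refl
occ-first {p} p≢q (k ∷ ks) = trans (occ-++ p (p ^ k) _)
  (cong₂ _+_ (occ-replicate p k) (occ-second (≢-sym p≢q) ks))
occ-second p≢q [] = refl
occ-second {p} {q} p≢q (k ∷ ks) = trans (occ-++ q (p ^ k) _)
  (cong₂ _+_ (occ-replicate-≢ k (≢-sym p≢q)) (occ-first (≢-sym p≢q) ks))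

-- Conjugate words are rearrangements of each other. Every refutation of a mesosome below rests on
-- this consequence alone.
mesosome-halves : Mesosome w → ∃[ x ] ∃[ y ]
  (w ≡ x ++ y × x ≢ y × length x ≡ length y × (∀ c → occ c x ≡ occ c y))
mesosome-halves (_ , _ , _ , refl , (u , v , refl , refl) , x≢y) =
  _ , _ , refl , x≢y , length-++-comm u v , λ c → occ-++-comm c u v

-- The run lengths js are those of the first half, which has half of each letter.
mesosome-half : ∀ k ks → p ≢ q → Mesosome (runs p q (k ∷ ks)) → ∃[ js ]
  (js ⊑ k ∷ ks × sumOdd (k ∷ ks) ≡ sumOdd js + sumOdd js
               × sumEven (k ∷ ks) ≡ sumEven js + sumEven js)
mesosome-half {p} {q} k ks p≢q mes with mesosome-halves mes
... | x , y , w≡xy , _ , _ , occ≡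
  with runs-prefix⁻ k ks (subst (Prefix _≡_ x) (sym w≡xy)
         (Prefix.fromView (Pointwise.refl refl Prefix.++ y)))
... | js , js⊑ , refl = js , js⊑ , doubled sumOdd (occ-first p≢q) , doubled sumEven (occ-second p≢q)
  where
  doubled : ∀ {c} f → (∀ is → occ c (runs p q is) ≡ f is) → f (k ∷ ks) ≡ f js + f js
  doubled {c} f occ≡f = begin
    f (k ∷ ks)                       ≡⟨ occ≡f (k ∷ ks) ⟨
    occ c (runs p q (k ∷ ks))        ≡⟨ cong (occ c) w≡xy ⟩
    occ c (runs p q js ++ y)         ≡⟨ occ-++ c (runs p q js) y ⟩
    occ c (runs p q js) + occ c y    ≡⟨ cong (occ c (runs p q js) +_) (occ≡ c) ⟨
    occ c (runs p q js) + occ c (runs p q js) ≡⟨ cong₂ _+_ (occ≡f js) (occ≡f js) ⟩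
    f js + f js                      ∎
    where open ≡-Reasoning

-- Shapes that are not mesosomes.

alternating : Bool → Bool → ℕ → Word
alternating p q n = runs p q (replicate n 1)

length-alternating : ∀ p q n → length (alternating p q n) ≡ n
length-alternating p q zero    = refl
length-alternating p q (suc n) = cong suc (length-alternating q p n)

-- The letter at which the alternation resumes after `x` depends only on the parity of `length x`.
alternating-++⁻ : ∀ x n → alternating p q n ≡ x ++ y →
  x ≡ alternating p q (length x) ×
  (((∃[ k ] length x ≡ k + k) × y ≡ alternating p q (length y)) ⊎
   ((∃[ k ] length x ≡ odd k) × y ≡ alternating q p (length y)))
alternating-++⁻ {p} {q} [] n refl =
  refl , inj₁ ((0 , refl) , cong (alternating p q) (sym (length-alternating p q n)))
alternating-++⁻ (_ ∷ x) (suc n) eq with ∷-injective eq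
... | refl , eq′ with alternating-++⁻ x n eq′
... | x≡ , inj₁ ((k , even) , y≡) = cong (_ ∷_) x≡ , inj₂ ((k , cong suc even) , y≡)
... | x≡ , inj₂ ((k , even) , y≡) =
  cong (_ ∷_) x≡ , inj₁ ((suc k , cong suc (trans even (sym (+-suc k k)))) , y≡)

sumOdd-ones : ∀ k → sumOdd (replicate (k + k) 1) ≡ k
sumOdd-ones zero    = refl
sumOdd-ones (suc k) rewrite +-suc k k = cong suc (sumOdd-ones k)

sumEven-ones : ∀ k → sumEven (replicate (k + k) 1) ≡ k
sumEven-ones zero    = refl
sumEven-ones (suc k) rewrite +-suc k k = cong suc (sumEven-ones k)

-- Halves of even length start with the same letter and coincide. Halves of length `odd k` start
-- with different letters, so `p` occurs `suc k` times in one and `k` times in the other. The case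
-- `p ≡ q`, where the halves coincide again, serves the constant words.
alternating-not-mesosome : ∀ p q n → ¬ Mesosome (alternating p q n)
alternating-not-mesosome p q n mes with mesosome-halves mes
... | x , y , w≡xy , x≢y , |x|≡|y| , occ≡ with alternating-++⁻ x n w≡xy
... | x≡ , inj₁ (_ , y≡) = x≢y (trans x≡ (trans (cong (alternating p q) |x|≡|y|) (sym y≡)))
... | x≡ , inj₂ ((k , |x|≡) , y≡) with p ≟ q
... | yes refl = x≢y (trans x≡ (trans (cong (alternating p q) |x|≡|y|) (sym y≡)))
... | no p≢q = 1+n≢n (begin
  suc k                                 ≡⟨ cong suc (sumEven-ones k) ⟨
  sumOdd (replicate (odd k) 1)          ≡⟨ occ-first p≢q (replicate (odd k) 1) ⟨
  occ p (alternating p q (odd k))       ≡⟨ cong (occ p ∘ alternating p q) |x|≡ ⟨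
  occ p (alternating p q (length x))    ≡⟨ cong (occ p) x≡ ⟨
  occ p x                               ≡⟨ occ≡ p ⟩
  occ p y                               ≡⟨ cong (occ p) y≡ ⟩
  occ p (alternating q p (length y))    ≡⟨ cong (occ p ∘ alternating q p)
                                              (trans (sym |x|≡|y|) |x|≡) ⟩
  occ p (alternating q p (odd k))       ≡⟨ occ-second (≢-sym p≢q) (replicate (odd k) 1) ⟩
  sumEven (replicate (odd k) 1)         ≡⟨ sumOdd-ones k ⟩
  k                                     ∎)
  where open ≡-Reasoning

alternating-constant : ∀ p n → alternating p p n ≡ p ^ n
alternating-constant p zero    = refl
alternating-constant p (suc n) = cong (p ∷_) (alternating-constant p n)

replicate-not-mesosome : ∀ p n → ¬ Mesosome (p ^ n)
replicate-not-mesosome p n =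
  alternating-not-mesosome p p n ∘ subst Mesosome (sym (alternating-constant p n))

-- The mean of `a` and `d` exceeds `a`, so the first half must reach into the third run. The mean of
-- `b` and `e` is below `b`, so it cannot contain the whole second run.
four-runs-not-mesosome : ∀ {a b d e} → p ≢ q → a < d → e < b →
  ¬ Mesosome (runs p q (a ∷ b ∷ d ∷ e ∷ []))
four-runs-not-mesosome {a = a} {b} {d} {e} p≢q a<d e<b mes
  with mesosome-half a (b ∷ d ∷ e ∷ []) p≢q mes
... | js , js⊑ , odd≡ , even≡ = go js⊑ odd≡ even≡
  where
  few-p : ∀ {k} → a + (d + 0) ≡ k + k → ¬ k ≤ a
  few-p {k} eq k≤a = <⇒≱ a<d
    (m+n≡k+k∧k≤m⇒n≤m (trans (cong (a +_) (sym (+-identityʳ d))) eq) k≤a)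
  many-q : ∀ {k} → b + (e + 0) ≡ k + k → ¬ b ≤ k
  many-q {k} eq b≤k = <⇒≱ e<b
    (m+n≡k+k∧m≤k⇒m≤n (trans (cong (b +_) (sym (+-identityʳ e))) eq) b≤k)
  go : ∀ {js} → js ⊑ a ∷ b ∷ d ∷ e ∷ [] →
    a + (d + 0) ≡ sumOdd js + sumOdd js → b + (e + 0) ≡ sumEven js + sumEven js → ⊥
  go (cut j≤a)               odd≡ _ = few-p odd≡ (≤-trans (≤-reflexive (+-identityʳ _)) j≤a)
  go (keep (cut _))          odd≡ _ = few-p odd≡ (≤-reflexive (+-identityʳ a))
  go (keep (keep (cut _)))   _ even≡ = many-q even≡ (m≤m+n b _)
  go (keep (keep (keep (cut _)))) _ even≡ = many-q even≡ (m≤m+n b _)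

-- The letter `q` occurs an odd number of times and cannot be shared equally by the halves.
three-runs-not-mesosome : ∀ {a i d} → p ≢ q → ¬ Mesosome (runs p q (a ∷ odd i ∷ d ∷ []))
three-runs-not-mesosome {a = a} {i} {d} p≢q mes
  with js , _ , _ , even≡ ← mesosome-half a (odd i ∷ d ∷ []) p≢q mes =
  odd≢even i (sumEven js) (trans (sym (+-identityʳ _)) even≡)

two-runs-not-mesosome : ∀ {a b} → p ≢ q → ¬ Mesosome (runs p q (a ∷ b ∷ []))
two-runs-not-mesosome {q = q} {zero} {b} p≢q =
  replicate-not-mesosome q b ∘ subst Mesosome (++-identityʳ _)
two-runs-not-mesosome {p} {a = suc a} {zero} p≢q =
  replicate-not-mesosome p (suc a) ∘ subst Mesosome (++-identityʳ _)
two-runs-not-mesosome {a = suc a} {suc b} p≢q =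
  -- Empty outer runs are added, which exchanges the roles of the letters.
  four-runs-not-mesosome {a = 0} {suc a} {suc b} {0} (≢-sym p≢q) (s≤s z≤n) (s≤s z≤n)

-- A cut in the first run gives the first half no `q`, and one in the last run gives it every `p`.
-- Any other cut gives it the whole first run and at most one `q`, which forces `a` and `e` to be
-- zero; the word is then the square `pqpq`.
step-not-mesosome : ∀ {a e} → p ≢ q → ¬ Mesosome (runs p q (suc a ∷ 1 ∷ 1 ∷ suc e ∷ []))
step-not-mesosome {p} {q} {a} {e} p≢q mes
  with mesosome-half (suc a) (1 ∷ 1 ∷ suc e ∷ []) p≢q mes
... | js , js⊑ , odd≡ , even≡ = go js⊑ odd≡ even≡
  where
  small-p : ∀ {k} → suc a ≤ k → suc a + 1 ≡ k + k → a ≡ 0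
  small-p le eq = n≤0⇒n≡0 (≤-pred (m+n≡k+k∧m≤k⇒m≤n eq le))
  small-q : ∀ {k} → k ≤ 1 → 1 + suc (e + 0) ≡ k + k → e ≡ 0
  small-q le eq = trans (sym (+-identityʳ e))
    (n≤0⇒n≡0 (≤-pred (m+n≡k+k∧k≤m⇒n≤m {1} eq le)))
  alternates : a ≡ 0 → e ≡ 0 → ⊥
  alternates refl refl = alternating-not-mesosome p q 4 mes
  go : ∀ {js} → js ⊑ suc a ∷ 1 ∷ 1 ∷ suc e ∷ [] →
    suc a + 1 ≡ sumOdd js + sumOdd js → 1 + suc (e + 0) ≡ sumEven js + sumEven js → ⊥
  go (cut _) _ ()
  go (keep (cut j≤1)) odd≡ even≡ =
    alternates (small-p (m≤m+n (suc a) 0) odd≡)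
               (small-q (≤-trans (≤-reflexive (+-identityʳ _)) j≤1) even≡)
  go (keep (keep (cut _))) odd≡ even≡ =
    alternates (small-p (m≤m+n (suc a) _) odd≡) (small-q ≤-refl even≡)
  go (keep (keep (keep (cut _)))) odd≡ _ =
    <⇒≢ (m<m+n (suc a + 1) (s≤s z≤n)) odd≡

-- Tame words.

-- Closed under taking factors and large enough to contain the proper factors of
-- the listed words.
data Tame : Word → Set where
  two   : ∀ {p q} a b → p ≢ q → Tame (runs p q (a ∷ b ∷ []))
  three : ∀ {p q} a i d → p ≢ q → Tame (runs p q (a ∷ odd i ∷ d ∷ []))
  four  : ∀ {p q} a i j e → p ≢ q → a < odd j → e < odd i →
          Tame (runs p q (a ∷ odd i ∷ odd j ∷ e ∷ []))

tame-not-mesosome : Tame w → ¬ Mesosome w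
tame-not-mesosome (two a b p≢q) = two-runs-not-mesosome {a = a} {b} p≢q
tame-not-mesosome (three a i d p≢q) = three-runs-not-mesosome {a = a} {i} {d} p≢q
tame-not-mesosome (four a i j e p≢q a< e<) =
  four-runs-not-mesosome {a = a} {odd i} {odd j} {e} p≢q a< e<

tame-prefix : Tame w → Prefix _≡_ s w → Tame s
tame-prefix (two a b p≢q) pre with runs-prefix⁻ a (b ∷ []) pre
... | _ , cut {j} _ , refl        = two j 0 p≢q
... | _ , keep (cut {j} _) , refl = two a j p≢q
tame-prefix (three a i d p≢q) pre with runs-prefix⁻ a (odd i ∷ d ∷ []) pre
... | _ , cut {j} _ , refl               = two j 0 p≢q
... | _ , keep (cut {j} _) , refl        = two a j p≢q
... | _ , keep (keep (cut {j} _)) , refl = three a i j p≢q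
tame-prefix (four a i j e p≢q a< e<) pre with runs-prefix⁻ a (odd i ∷ odd j ∷ e ∷ []) pre
... | _ , cut {k} _ , refl               = two k 0 p≢q
... | _ , keep (cut {k} _) , refl        = two a k p≢q
... | _ , keep (keep (cut {k} _)) , refl = three a i k p≢q
... | _ , keep (keep (keep (cut {k} k≤e))) , refl = four a i j k p≢q a< (≤-<-trans k≤e e<)

-- Only interior runs must be odd. When the first run is empty, the shortened second run takes its
-- place and its parity no longer matters.
tame-tail : ∀ {c} → Tame w → w ≡ c ∷ s → Tame s
tame-tail (two zero (suc b) p≢q) refl = two b 0 (≢-sym p≢q)
tame-tail (two (suc a) b p≢q) refl = two a b p≢q
tame-tail (three zero i d p≢q) refl = two (i + i) d (≢-sym p≢q)
tame-tail (three (suc a) i d p≢q) refl = three a i d p≢q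
tame-tail (four zero i j e p≢q a< e<) refl = three (i + i) j e (≢-sym p≢q)
tame-tail (four (suc a) i j e p≢q a< e<) refl = four a i j e p≢q (<-trans (n<1+n a) a<) e<

tame-infix : Tame w → Infix _≡_ s w → Tame s
tame-infix tame (here pre)  = tame-prefix tame pre
tame-infix tame (there inf) = tame-infix (tame-tail tame refl) inf

-- The obstructions and why they are mesosomes.

-- The mesosomes p^a q^b p^a q, p q^a p^b q^a (a, b odd, b ≥ 3) and p q^k p (k ≥ 2 even).
data Family : Set where
  family₁ family₂ : (i j : ℕ) → Family
  family₃ : (k : ℕ) → Family

familyRuns : Family → List ℕ
familyRuns (family₁ i j) = odd i ∷ odd (suc j) ∷ odd i ∷ 1 ∷ []
familyRuns (family₂ i j) = 1 ∷ odd i ∷ odd (suc j) ∷ odd i ∷ []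
familyRuns (family₃ k)   = 1 ∷ suc k + suc k ∷ 1 ∷ []

data Obstruction : Set where
  family : Family → Obstruction
  short₁ : Obstruction
  short₂ : Obstruction

obstructionRuns : Obstruction → List ℕ
obstructionRuns (family l) = familyRuns l
obstructionRuns short₁     = 2 ∷ 1 ∷ 1 ∷ 1 ∷ 1 ∷ []
obstructionRuns short₂     = 1 ∷ 1 ∷ 1 ∷ 1 ∷ 2 ∷ []

conjugates-mesosome : ∀ u v → w ≡ (u ++ v) ++ (v ++ u) → u ++ v ≢ v ++ u → Mesosome w
conjugates-mesosome u v refl uv≢vu =
  (λ eq → uv≢vu (trans (++-conicalˡ (u ++ v) _ eq) (sym (++-conicalʳ (u ++ v) _ eq)))) ,
  _ , _ , refl , (u , v , refl , refl) , uv≢vu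

replicate-split : ∀ k l → p ^ (k + l) ++ w ≡ p ^ k ++ p ^ l ++ w
replicate-split zero    l = refl
replicate-split (suc k) l = cong (_ ∷_) (replicate-split k l)

-- Each word reads `u v v u` with `v` a power of one letter. The two copies of `v` fill the even run
-- of `family₃`; in the long odd run of the others one more letter remains, which belongs to `u`.
family-mesosome : ∀ l → p ≢ q → Mesosome (runs p q (familyRuns l))
family-mesosome {p} {q} (family₁ i j) p≢q = conjugates-mesosome (p ^ odd i ++ q ∷ []) (q ^ suc j)
  (begin
    p ^ odd i ++ q ^ (suc (suc j) + suc j) ++ z
      ≡⟨ cong (p ^ odd i ++_) (replicate-split (suc (suc j)) (suc j)) ⟩
    p ^ odd i ++ (q ∷ []) ++ q ^ suc j ++ q ^ suc j ++ z
      ≡⟨ ++-assoc (p ^ odd i) (q ∷ []) _ ⟨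
    u ++ q ^ suc j ++ q ^ suc j ++ z
      ≡⟨ ++-assoc u (q ^ suc j) _ ⟨
    (u ++ q ^ suc j) ++ q ^ suc j ++ z ∎)
  (p≢q ∘ ∷-injectiveˡ)
  where
  open ≡-Reasoning
  z = p ^ odd i ++ q ∷ []
  u = p ^ odd i ++ q ∷ []
family-mesosome {p} {q} (family₂ i j) p≢q = conjugates-mesosome (p ∷ q ^ odd i) (p ^ suc j)
  (cong (p ∷_) (begin
    q ^ odd i ++ p ^ (suc (suc j) + suc j) ++ q ^ odd i ++ []
      ≡⟨ cong₂ (λ m z → q ^ odd i ++ p ^ m ++ z) (sym (+-suc (suc j) (suc j))) (++-identityʳ _) ⟩
    q ^ odd i ++ p ^ (suc j + suc (suc j)) ++ q ^ odd i
      ≡⟨ cong (q ^ odd i ++_) (replicate-split (suc j) (suc (suc j))) ⟩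
    q ^ odd i ++ p ^ suc j ++ p ^ suc (suc j) ++ q ^ odd i
      ≡⟨ cong (λ z → q ^ odd i ++ p ^ suc j ++ z)
           (trans (cong (λ m → p ^ m ++ q ^ odd i) (+-comm 1 (suc j))) (replicate-split (suc j) 1)) ⟩
    q ^ odd i ++ p ^ suc j ++ p ^ suc j ++ p ∷ q ^ odd i
      ≡⟨ ++-assoc (q ^ odd i) (p ^ suc j) _ ⟨
    (q ^ odd i ++ p ^ suc j) ++ p ^ suc j ++ p ∷ q ^ odd i ∎))
  -- Both halves start with `p`, so they are told apart at the second letter.
  (p≢q ∘ sym ∘ second j ∘ ∷-injectiveʳ)
  where
  open ≡-Reasoning
  second : ∀ j {u v} → q ∷ u ≡ p ^ j ++ p ∷ v → q ≡ p
  second zero    eq = ∷-injectiveˡ eq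
  second (suc j) eq = ∷-injectiveˡ eq
family-mesosome {p} {q} (family₃ k) p≢q = conjugates-mesosome (p ∷ []) (q ^ suc k)
  (cong (p ∷_) (replicate-split (suc k) (suc k))) (p≢q ∘ ∷-injectiveˡ)

obstruction-mesosome : ∀ o → p ≢ q → Mesosome (runs p q (obstructionRuns o))
obstruction-mesosome (family l) p≢q = family-mesosome l p≢q
obstruction-mesosome {p} {q} short₁ p≢q = conjugates-mesosome (p ∷ []) (p ∷ q ∷ []) refl
  (p≢q ∘ ∷-injectiveˡ ∘ ∷-injectiveʳ)
obstruction-mesosome {p} {q} short₂ p≢q = conjugates-mesosome (p ∷ []) (q ∷ p ∷ []) refl
  (p≢q ∘ ∷-injectiveˡ)

-- Minimality of the family words.

family-prefix-tame : ∀ l → p ≢ q →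
  Prefix _≡_ s (runs p q (familyRuns l)) → s ≢ runs p q (familyRuns l) → Tame s
family-prefix-tame (family₁ i j) p≢q pre s≢
  with runs-prefix⁻ (odd i) (odd (suc j) ∷ odd i ∷ 1 ∷ []) pre
... | _ , cut {k} _ , refl               = two k 0 p≢q
... | _ , keep (cut {k} _) , refl        = two (odd i) k p≢q
... | _ , keep (keep (cut {k} _)) , refl = three (odd i) (suc j) k p≢q
... | _ , keep (keep (keep (cut z≤n))) , refl       = three (odd i) (suc j) (odd i) p≢q
... | _ , keep (keep (keep (cut (s≤s z≤n)))) , refl = contradiction refl s≢
family-prefix-tame (family₂ i j) p≢q pre s≢
  with runs-prefix⁻ 1 (odd i ∷ odd (suc j) ∷ odd i ∷ []) pre
... | _ , cut {k} _ , refl               = two k 0 p≢q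
... | _ , keep (cut {k} _) , refl        = two 1 k p≢q
... | _ , keep (keep (cut {k} _)) , refl = three 1 i k p≢q
... | _ , keep (keep (keep (cut {k} k≤))) , refl with m≤n⇒m<n∨m≡n k≤
-- A proper prefix cuts the last run strictly below `odd i`, the bound that `four` requires.
...   | inj₁ k<   = four 1 i (suc j) k p≢q (s≤s (s≤s z≤n)) k<
...   | inj₂ refl = contradiction refl s≢
family-prefix-tame (family₃ k) p≢q pre s≢ with runs-prefix⁻ 1 (suc k + suc k ∷ 1 ∷ []) pre
... | _ , cut {j} _ , refl                   = two j 0 p≢q
... | _ , keep (cut {j} _) , refl            = two 1 j p≢q
... | _ , keep (keep (cut z≤n)) , refl       = two 1 (suc k + suc k) p≢q
... | _ , keep (keep (cut (s≤s z≤n))) , refl = contradiction refl s≢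

family-tail-tame : ∀ {c} l → p ≢ q → runs p q (familyRuns l) ≡ c ∷ w → Tame w
family-tail-tame (family₁ i j) p≢q refl =
  -- Losing one letter makes the first run strictly shorter than the third.
  four (i + i) (suc j) i 1 p≢q (n<1+n _) (s≤s (s≤s z≤n))
family-tail-tame (family₂ i j) p≢q refl = three (odd i) (suc j) (odd i) (≢-sym p≢q)
family-tail-tame (family₃ k) p≢q refl = two (suc k + suc k) 1 (≢-sym p≢q)

-- A proper factor is either a proper prefix or a factor of the word without its first letter, and
-- both kinds are tame.
family-minimal : ∀ l → p ≢ q → MinimalForbidden (runs p q (familyRuns l))
family-minimal {p} {q} l p≢q =
  family-mesosome l p≢q , λ s (inf , s≢) → tame-not-mesosome (go refl inf s≢)
  where
  go : w ≡ runs p q (familyRuns l) → Infix _≡_ s w → s ≢ w → Tame s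
  go eq (here pre)    s≢ =
    family-prefix-tame l p≢q (subst (Prefix _≡_ _) eq pre) (subst (_ ≢_) eq s≢)
  go eq   (there inf) s≢ = tame-infix (family-tail-tame l p≢q (sym eq)) inf

-- Classification of all words, letter by letter from the right.

-- In `step` the interior runs have length one, for which the bounds of `four` would leave only
-- empty end runs.
data Free : Word → Set where
  tame : Tame w → Free w
  step : ∀ {p q} a e → p ≢ q → Free (runs p q (suc a ∷ 1 ∷ 1 ∷ suc e ∷ []))
  alternate : ∀ {p q} n → p ≢ q → Free (alternating p q n)

free-not-mesosome : Free w → ¬ Mesosome w
free-not-mesosome (tame t) = tame-not-mesosome t
free-not-mesosome (step a e p≢q) = step-not-mesosome {a = a} {e} p≢q
free-not-mesosome (alternate n _) = alternating-not-mesosome _ _ n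

-- The words examined arise by putting a letter in front of a free word, so an obstruction is sought
-- only as a prefix.
data Outcome (p q : Bool) (ks : List ℕ) : Set where
  contains : ∀ o → obstructionRuns o ⊑ ks → Outcome p q ks
  free     : Free (runs p q ks) → Outcome p q ks

-- A new first letter makes `a` an interior run. If `a` is zero, the letter merges with the run
-- after it; if `a` is even and positive, a `family₃` word appears; if `a` is odd, the word is tame.
prepend-two : ∀ a b → p ≢ q → Outcome p q (1 ∷ a ∷ b ∷ [])
prepend-two a zero p≢q = free (tame (two 1 a p≢q))
prepend-two a (suc b) p≢q with parity a
... | isEven zero    = free (tame (two (suc (suc b)) 0 p≢q))
... | isEven (suc k) = contains (family (family₃ k)) (keep (keep (cut (s≤s z≤n))))
... | isOdd k        = free (tame (three 1 k (suc b) p≢q))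

-- The new case is `a` odd with a nonempty last run. If the third run is a single letter, `family₁`
-- appears unless `a` is one. If it is longer, `family₂` appears as soon as the last run has length
-- at least `a`; otherwise the bounds of `four` hold.
prepend-three : ∀ a i d → p ≢ q → Outcome p q (1 ∷ a ∷ odd i ∷ d ∷ [])
prepend-three a i zero p≢q with prepend-two a (odd i) p≢q
... | free f         = free f
... | contains o js⊑ = contains o (weaken js⊑)
  where
  weaken : ∀ {js x y z} → js ⊑ x ∷ y ∷ z ∷ [] → js ⊑ x ∷ y ∷ z ∷ 0 ∷ []
  weaken (cut ≤)               = cut ≤
  weaken (keep (cut ≤))        = keep (cut ≤)
  weaken (keep (keep (cut ≤))) = keep (keep (cut ≤))
prepend-three a i (suc d) p≢q with parity a
... | isEven zero    = free (tame (two (suc (odd i)) (suc d) p≢q))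
... | isEven (suc k) = contains (family (family₃ k)) (keep (keep (cut (s≤s z≤n))))
prepend-three _ zero (suc d) p≢q | isOdd zero = free (step 0 d p≢q)
prepend-three _ zero (suc d) p≢q | isOdd (suc k) =
  contains (family (family₁ 0 k)) (keep (keep (keep (cut (s≤s z≤n)))))
prepend-three _ (suc i) (suc d) p≢q | isOdd k with odd k ≤? suc d
... | yes k≤d = contains (family (family₂ k i)) (keep (keep (keep (cut k≤d))))
... | no  k≰d =
  free (tame (four 1 k (suc i) (suc d) p≢q (s≤s (s≤s z≤n)) (≰⇒> k≰d)))

prepend-four : ∀ a i j e → p ≢ q → a < odd j → suc e < odd i →
  Outcome p q (1 ∷ a ∷ odd i ∷ odd j ∷ suc e ∷ [])
prepend-four a zero j e p≢q _ (s≤s ())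
prepend-four a (suc i) j e p≢q a<j e<i with parity a
... | isEven zero    = free (tame (three (suc (odd (suc i))) j (suc e) p≢q))
... | isEven (suc k) = contains (family (family₃ k)) (keep (keep (cut (s≤s z≤n))))
-- The bound `a < odd j` makes the fourth run long enough to repeat the second.
... | isOdd k        = contains (family (family₂ k i)) (keep (keep (keep (cut (<⇒≤ a<j)))))

prepend-step : ∀ a e → p ≢ q → Outcome p q (1 ∷ suc a ∷ 1 ∷ 1 ∷ suc e ∷ [])
prepend-step a e p≢q with parity a
... | isEven (suc k) = contains (family (family₁ 0 k)) (keep (keep (keep (cut (s≤s z≤n)))))
... | isOdd k rewrite sym (+-suc k k) =
  contains (family (family₃ k)) (keep (keep (cut (s≤s z≤n))))
prepend-step _ zero    p≢q | isEven zero = free (alternate 5 p≢q)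
prepend-step _ (suc e) p≢q | isEven zero =
  contains short₂ (keep (keep (keep (keep (cut (s≤s (s≤s z≤n)))))))

-- The bound on the first run can fail only by equality with the third, and this produces a
-- `family₁` word.
widen-four : ∀ a i j e → p ≢ q → a < odd j → suc e < odd i →
  Outcome p q (suc a ∷ odd i ∷ odd j ∷ suc e ∷ [])
widen-four a zero j e p≢q _ (s≤s ())
widen-four a (suc i) j e p≢q a<j e<i with m≤n⇒m<n∨m≡n a<j
... | inj₁ a+1<j = free (tame (four (suc a) (suc i) j (suc e) p≢q a+1<j e<i))
... | inj₂ refl  = contains (family (family₁ j i)) (keep (keep (keep (cut (s≤s z≤n)))))

widen-alternating : ∀ n → p ≢ q → Outcome p q (2 ∷ replicate n 1)
widen-alternating 0 p≢q = free (tame (two 2 0 p≢q))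
widen-alternating 1 p≢q = free (tame (two 2 1 p≢q))
widen-alternating 2 p≢q = free (tame (three 2 0 1 p≢q))
widen-alternating 3 p≢q = free (step 1 0 p≢q)
widen-alternating (suc (suc (suc (suc n)))) p≢q =
  contains short₁ (keep (keep (keep (keep (cut (s≤s z≤n))))))

one-of : p ≢ q → ∀ c → c ≡ p ⊎ c ≡ q
one-of {p} p≢q c with c ≟ p
... | yes c≡p = inj₁ c≡p
... | no  c≢p = inj₂ (trans (¬-not c≢p) (sym (¬-not (≢-sym p≢q))))

ContainsObstruction : Word → Set
ContainsObstruction w = ∃[ p ] ∃[ q ] (p ≢ q × ∃[ o ]
  Infix _≡_ (runs p q (obstructionRuns o)) w)

resolve : ∀ {ks} → p ≢ q → Outcome p q ks →
  ContainsObstruction (runs p q ks) ⊎ Free (runs p q ks)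
resolve p≢q (contains o js⊑) = inj₁ (_ , _ , p≢q , o , here (runs-prefix⁺ js⊑))
resolve p≢q (free f)         = inj₂ f

extend : ∀ c → Free w → ContainsObstruction (c ∷ w) ⊎ Free (c ∷ w)
extend c (tame (two a b p≢q)) with one-of p≢q c
... | inj₁ refl = inj₂ (tame (two (suc a) b p≢q))
... | inj₂ refl = resolve (≢-sym p≢q) (prepend-two a b (≢-sym p≢q))
extend c (tame (three a i d p≢q)) with one-of p≢q c
... | inj₁ refl = inj₂ (tame (three (suc a) i d p≢q))
... | inj₂ refl = resolve (≢-sym p≢q) (prepend-three a i d (≢-sym p≢q))
-- With its last run empty, this is a word of three runs ending in `odd j`.
extend c (tame (four a i j zero p≢q _ _)) = extend c (tame (three a i (odd j) p≢q))
extend c (tame (four a i j (suc e) p≢q a<j e<i)) with one-of p≢q c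
... | inj₁ refl = resolve p≢q (widen-four a i j e p≢q a<j e<i)
... | inj₂ refl = resolve (≢-sym p≢q) (prepend-four a i j e (≢-sym p≢q) a<j e<i)
extend c (step a e p≢q) with one-of p≢q c
... | inj₁ refl = inj₂ (step (suc a) e p≢q)
... | inj₂ refl = resolve (≢-sym p≢q) (prepend-step a e (≢-sym p≢q))
extend c (alternate n p≢q) with one-of p≢q c
extend c (alternate zero    p≢q) | inj₁ refl = inj₂ (alternate 1 p≢q)
extend c (alternate (suc n) p≢q) | inj₁ refl = resolve p≢q (widen-alternating n p≢q)
extend c (alternate n       p≢q) | inj₂ refl = inj₂ (alternate (suc n) (≢-sym p≢q))

classify : ∀ w → ContainsObstruction w ⊎ Free w
classify [] = inj₂ (alternate {𝟎} {𝟏} 0 λ ())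
classify (c ∷ w) with classify w
... | inj₁ (p , q , p≢q , o , inf) = inj₁ (p , q , p≢q , o , there inf)
... | inj₂ f                       = extend c f

-- Obstructions are mesosomes, so a minimal word cannot contain one as a proper factor.
minimal⇒obstruction : MinimalForbidden w →
  ∃[ p ] ∃[ q ] (p ≢ q × ∃[ o ] w ≡ runs p q (obstructionRuns o))
minimal⇒obstruction {w} (mes , min) with classify w
... | inj₂ f = contradiction mes (free-not-mesosome f)
... | inj₁ (p , q , p≢q , o , inf) with ≡-dec _≟_ (runs p q (obstructionRuns o)) w
...   | yes eq = p , q , p≢q , o , sym eq
...   | no s≢w = contradiction (obstruction-mesosome o p≢q) (min _ (inf , s≢w))

minimal⇒family : MinimalForbidden w → 8 ≤ length w →
  ∃[ p ] ∃[ q ] (p ≢ q × ∃[ l ] w ≡ runs p q (familyRuns l))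
minimal⇒family mf 8≤ with minimal⇒obstruction mf
... | p , q , p≢q , family l , eq = p , q , p≢q , l , eq
-- The short obstructions have length six.
... | _ , _ , _ , short₁ , refl =
  contradiction 8≤ λ { (s≤s (s≤s (s≤s (s≤s (s≤s (s≤s ())))))) }
... | _ , _ , _ , short₂ , refl =
  contradiction 8≤ λ { (s≤s (s≤s (s≤s (s≤s (s≤s (s≤s ())))))) }

-- Lengths, complements and uniqueness of the run encoding.

length-runs : ∀ p q ks → length (runs p q ks) ≡ sum ks
length-runs p q []       = refl
length-runs p q (k ∷ ks) =
  trans (length-++ (p ^ k)) (cong₂ _+_ (length-replicate k) (length-runs q p ks))

complement-runs : ∀ p q ks → complement (runs p q ks) ≡ runs (not p) (not q) ks
complement-runs p q []       = refl
complement-runs p q (k ∷ ks) =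
  trans (map-++ not (p ^ k) _) (cong₂ _++_ (map-replicate not k p) (complement-runs q p ks))

runs-injective : ∀ {ks ls} → p ≢ q → All (0 <_) ks → All (0 <_) ls →
  runs p q ks ≡ runs p q ls → ks ≡ ls
runs-injective p≢q [] [] _ = refl
runs-injective p≢q [] (s≤s z≤n ∷ _) ()
runs-injective p≢q (s≤s z≤n ∷ _) [] ()
runs-injective {p} {q} {suc k ∷ ks} {suc l ∷ ls} p≢q (_ ∷ ks>0) (_ ∷ ls>0) eq =
  go k l (∷-injectiveʳ eq)
  where
  head≢ : ∀ {ks w} → All (0 <_) ks → runs q p ks ≢ p ∷ w
  head≢ (s≤s z≤n ∷ _) eq = p≢q (sym (∷-injectiveˡ eq))
  go : ∀ k l → runs p q (k ∷ ks) ≡ runs p q (l ∷ ls) → suc k ∷ ks ≡ suc l ∷ ls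
  go zero    zero    eq = cong (1 ∷_) (runs-injective (≢-sym p≢q) ks>0 ls>0 eq)
  go zero    (suc l) eq = contradiction eq (head≢ ks>0)
  go (suc k) zero    eq = contradiction (sym eq) (head≢ ls>0)
  go (suc k) (suc l) eq with ∷-injective (go k l (∷-injectiveʳ eq))
  ... | refl , refl = refl

odd-injective : ∀ {i j} → odd i ≡ odd j → i ≡ j
odd-injective {i} {j} eq =
  trans (n≡⌊n+n/2⌋ i) (trans (cong ⌊_/2⌋ (suc-injective eq)) (sym (n≡⌊n+n/2⌋ j)))

runs-head : ∀ {p q p′ q′ ks ls} → All (0 <_) ks → All (0 <_) ls → 0 < length ks →
  runs p q ks ≡ runs p′ q′ ls → p ≡ p′
runs-head (s≤s z≤n ∷ _) (s≤s z≤n ∷ _) _ eq = ∷-injectiveˡ eq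
runs-head (s≤s z≤n ∷ _) []            _ ()

familyRuns-nonempty : ∀ l → 0 < length (familyRuns l)
familyRuns-nonempty (family₁ _ _) = s≤s z≤n
familyRuns-nonempty (family₂ _ _) = s≤s z≤n
familyRuns-nonempty (family₃ _)   = s≤s z≤n

-- In this form, fixing the length amounts to fixing `2 * i + j`.
sum-family₁ : ∀ i j → sum (familyRuns (family₁ i j)) ≡ 6 + 2 * (2 * i + j)
sum-family₁ i j = identity i j
  where
  identity : ∀ i j → suc (i + i) + (suc (suc j + suc j) + (suc (i + i) + 1)) ≡
    6 + 2 * (2 * i + j)
  identity = solve-∀

sum-family₂ : ∀ i j → sum (familyRuns (family₂ i j)) ≡ 6 + 2 * (2 * i + j)
sum-family₂ i j = identity i j
  where
  identity : ∀ i j → 1 + (suc (i + i) + (suc (suc j + suc j) + (suc (i + i) + 0))) ≡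
    6 + 2 * (2 * i + j)
  identity = solve-∀

sum-family₃ : ∀ k → sum (familyRuns (family₃ k)) ≡ 4 + 2 * k
sum-family₃ k = identity k
  where
  identity : ∀ k → 1 + (suc k + suc k + 1) ≡ 4 + 2 * k
  identity = solve-∀

-- Enumeration of the minimal words of one length.

-- The index i is one less than the i of word₁ and word₂.
data Code : Set where
  rising falling : (i : ℕ) → Code
  hill           : Code

module Enumeration (m r : ℕ) (r≤1 : r ≤ 1) where

  -- Every even n ≥ 6 has this form: r = 1 if n ≡ 0 (mod 4), r = 0 if n ≡ 2 (mod 4).
  n : ℕ
  n = 6 + 2 * (2 * m + r)

  -- For `i ≤ m` this is the second family index that gives total length `n`, the solution `j` of
  -- `2 * i + j ≡ 2 * m + r`.
  gap : ℕ → ℕ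
  gap i = 2 * (m ∸ i) + r

  family-of : Code → Family
  family-of (rising i)  = family₁ i (gap i)
  family-of (falling i) = family₂ i (gap i)
  family-of hill        = family₃ (suc (2 * m + r))

  codeword : Bool → Code → Word
  codeword c = runs c (not c) ∘ familyRuns ∘ family-of

  codeword-positive : ∀ k → All (0 <_) (familyRuns (family-of k))
  codeword-positive (rising i)  = s≤s z≤n ∷ s≤s z≤n ∷ s≤s z≤n ∷ s≤s z≤n ∷ []
  codeword-positive (falling i) = s≤s z≤n ∷ s≤s z≤n ∷ s≤s z≤n ∷ s≤s z≤n ∷ []
  codeword-positive hill        = s≤s z≤n ∷ s≤s z≤n ∷ s≤s z≤n ∷ []

  -- Equal first runs force `i` to be zero; the third runs then have length one and at least three.
  rising≢falling : ∀ i j → familyRuns (family-of (rising i)) ≢ familyRuns (family-of (falling j))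
  rising≢falling i j eq with ∷-injective eq
  ... | i≡0 , eq′ with odd-injective {i} {0} i≡0
  ...   | refl with odd-injective {0} {suc (gap j)} (∷-injectiveˡ (∷-injectiveʳ eq′))
  ...     | ()

  familyRuns-injective : ∀ k l → familyRuns (family-of k) ≡ familyRuns (family-of l) → k ≡ l
  familyRuns-injective (rising i)  (rising j)  eq = cong rising (odd-injective (∷-injectiveˡ eq))
  familyRuns-injective (rising i)  (falling j) eq = contradiction eq (rising≢falling i j)
  familyRuns-injective (rising i)  hill        eq = contradiction (cong length eq) λ ()
  familyRuns-injective (falling i) (rising j)  eq = contradiction (sym eq) (rising≢falling j i)
  familyRuns-injective (falling i) (falling j) eq =
    cong falling (odd-injective (∷-injectiveˡ (∷-injectiveʳ eq)))
  familyRuns-injective (falling i) hill        eq = contradiction (cong length eq) λ ()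
  familyRuns-injective hill        (rising j)  eq = contradiction (cong length eq) λ ()
  familyRuns-injective hill        (falling j) eq = contradiction (cong length eq) λ ()
  familyRuns-injective hill        hill        eq = refl

  codeword-injective : ∀ {c d k l} → codeword c k ≡ codeword d l → c ≡ d × k ≡ l
  codeword-injective {c} {d} {k} {l} eq
    with runs-head (codeword-positive k) (codeword-positive l) (familyRuns-nonempty (family-of k)) eq
  ... | refl = refl , familyRuns-injective k l
    (runs-injective (not-¬ refl) (codeword-positive k) (codeword-positive l) eq)

  codes : List Code
  codes = hill ∷ map rising (upTo (suc m)) ++ map falling (upTo (suc m))

  codes-unique : Unique codes
  codes-unique =
    All.++⁺ (hill≢ rising λ _ ()) (hill≢ falling λ _ ()) ∷
    Unique.++⁺ (Unique.map⁺ (λ { refl → refl }) (Unique.upTo⁺ (suc m)))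
               (Unique.map⁺ (λ { refl → refl }) (Unique.upTo⁺ (suc m)))
               disjoint
    where
    hill≢ : ∀ f → (∀ i → hill ≢ f i) → All (hill ≢_) (map f (upTo (suc m)))
    hill≢ f hill≢f = All.map⁺ (All.universal hill≢f (upTo (suc m)))
    disjoint : ∀ {k} → ¬ (k ∈ map rising (upTo (suc m)) × k ∈ map falling (upTo (suc m)))
    disjoint (∈rising , ∈falling) with ∈-map⁻ rising ∈rising | ∈-map⁻ falling ∈falling
    ... | _ , _ , refl | _ , _ , ()

  data Valid : Code → Set where
    rising  : ∀ {i} → i ≤ m → Valid (rising i)
    falling : ∀ {i} → i ≤ m → Valid (falling i)
    hill    : Valid hill

  ∈codes⇒valid : ∀ {k} → k ∈ codes → Valid k
  ∈codes⇒valid (here refl) = hill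
  ∈codes⇒valid (there k∈) with ∈-++⁻ (map rising (upTo (suc m))) k∈
  ... | inj₁ k∈rising with ∈-map⁻ rising k∈rising
  ...   | i , i∈ , refl = rising (≤-pred (∈-upTo⁻ i∈))
  ∈codes⇒valid (there k∈) | inj₂ k∈falling with ∈-map⁻ falling k∈falling
  ...   | i , i∈ , refl = falling (≤-pred (∈-upTo⁻ i∈))

  valid⇒∈codes : ∀ {k} → Valid k → k ∈ codes
  valid⇒∈codes (rising i≤m)  = there (∈-++⁺ˡ (∈-map⁺ rising (∈-upTo⁺ (s≤s i≤m))))
  valid⇒∈codes (falling i≤m) =
    there (∈-++⁺ʳ (map rising (upTo (suc m))) (∈-map⁺ falling (∈-upTo⁺ (s≤s i≤m))))
  valid⇒∈codes hill          = here refl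

  Coded : Word → Set
  Coded w = ∃[ c ] ∃[ k ] (Valid k × w ≡ codeword c k)

  2i+gap : ∀ {i} → i ≤ m → 2 * i + gap i ≡ 2 * m + r
  2i+gap {i} i≤m = begin
    2 * i + (2 * (m ∸ i) + r) ≡⟨ regroup i (m ∸ i) r ⟩
    2 * (i + (m ∸ i)) + r     ≡⟨ cong (λ z → 2 * z + r) (m+[n∸m]≡n i≤m) ⟩
    2 * m + r                 ∎
    where
    open ≡-Reasoning
    regroup : ∀ i k r → 2 * i + (2 * k + r) ≡ 2 * (i + k) + r
    regroup = solve-∀

  -- Since `r ≤ 1`, `2 * i` is below `2 * suc m`, which bounds `i`; then `j` follows by
  -- cancellation.
  gap-unique : ∀ {i j} → 2 * i + j ≡ 2 * m + r → i ≤ m × j ≡ gap i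
  gap-unique {i} {j} eq = i≤m , +-cancelˡ-≡ (2 * i) j (gap i) (trans eq (sym (2i+gap i≤m)))
    where
    2i<2[1+m] : 2 * i < 2 * suc m
    2i<2[1+m] = begin-strict
      2 * i       ≤⟨ m≤m+n (2 * i) j ⟩
      2 * i + j   ≡⟨ eq ⟩
      2 * m + r   ≤⟨ +-monoʳ-≤ (2 * m) r≤1 ⟩
      2 * m + 1   <⟨ +-monoʳ-< (2 * m) (n<1+n 1) ⟩
      2 * m + 2   ≡⟨ +-comm (2 * m) 2 ⟩
      2 + 2 * m   ≡⟨ *-suc 2 m ⟨
      2 * suc m   ∎
      where open ≤-Reasoning
    i≤m : i ≤ m
    i≤m = ≤-pred (*-cancelˡ-< 2 i (suc m) 2i<2[1+m])

  cancel : ∀ {a b} → 6 + 2 * a ≡ 6 + 2 * b → a ≡ b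
  cancel {a} {b} eq = *-cancelˡ-≡ a b 2 (+-cancelˡ-≡ 6 (2 * a) (2 * b) eq)

  n≡ : n ≡ 4 + 2 * suc (2 * m + r)
  n≡ = cong (4 +_) (sym (*-suc 2 (2 * m + r)))

  minimal⇒coded : 8 ≤ n → MinimalForbiddenOfLength n w → Coded w
  minimal⇒coded 8≤n (mf , |w|≡n)
    with minimal⇒family mf (≤-trans 8≤n (≤-reflexive (sym |w|≡n)))
  ... | p , q , p≢q , l , refl with ¬-not (≢-sym p≢q)
  ... | refl = p , code l (trans (sym (length-runs p q (familyRuns l))) |w|≡n)
    where
    code : ∀ l → sum (familyRuns l) ≡ n →
      ∃[ k ] (Valid k × runs p (not p) (familyRuns l) ≡ codeword p k)
    code (family₁ i j) eq with gap-unique {i} (cancel (trans (sym (sum-family₁ i j)) eq))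
    ... | i≤m , refl = rising i , rising i≤m , refl
    code (family₂ i j) eq with gap-unique {i} (cancel (trans (sym (sum-family₂ i j)) eq))
    ... | i≤m , refl = falling i , falling i≤m , refl
    code (family₃ k) eq with *-cancelˡ-≡ k (suc (2 * m + r)) 2
      (+-cancelˡ-≡ 4 (2 * k) _ (trans (sym (sum-family₃ k)) (trans eq n≡)))
    ... | refl = hill , hill , refl

  valid-sum : ∀ {k} → Valid k → sum (familyRuns (family-of k)) ≡ n
  valid-sum (rising {i} i≤m)  = trans (sum-family₁ i (gap i)) (cong (λ z → 6 + 2 * z) (2i+gap i≤m))
  valid-sum (falling {i} i≤m) = trans (sum-family₂ i (gap i)) (cong (λ z → 6 + 2 * z) (2i+gap i≤m))
  valid-sum hill              = trans (sum-family₃ (suc (2 * m + r))) (sym n≡)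

  coded⇒minimal : Coded w → MinimalForbiddenOfLength n w
  coded⇒minimal (c , k , valid , refl) =
    family-minimal (family-of k) (not-¬ refl) ,
    trans (length-runs c (not c) (familyRuns (family-of k))) (valid-sum valid)

  codewords : List Word
  codewords = cartesianProductWith codeword (𝟎 ∷ 𝟏 ∷ []) codes

  codewords-unique : Unique codewords
  codewords-unique = Unique.cartesianProductWith⁺ codeword codeword-injective
    (((λ ()) ∷ []) ∷ [] ∷ []) codes-unique

  length-codes : length codes ≡ 1 + (suc m + suc m)
  length-codes = cong suc (trans (length-++ (map rising (upTo (suc m))))
    (cong₂ _+_ (length-mapped rising) (length-mapped falling)))
    where
    length-mapped : (f : ℕ → Code) → length (map f (upTo (suc m))) ≡ suc m
    length-mapped f = trans (length-map f (upTo (suc m))) (length-upTo (suc m))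

  -- This is `n ∸ 2` when `r` is one and `n` when `r` is zero, which accounts for the two counts of
  -- the theorem.
  length-codewords : length codewords ≡ 6 + 4 * m
  length-codewords = begin
    length codewords
      ≡⟨ length-++ (map (codeword 𝟎) codes) ⟩
    length (map (codeword 𝟎) codes) + length (map (codeword 𝟏) codes ++ [])
      ≡⟨ cong₂ _+_ (length-map (codeword 𝟎) codes)
           (trans (cong length (++-identityʳ (map (codeword 𝟏) codes)))
                  (length-map (codeword 𝟏) codes)) ⟩
    length codes + length codes
      ≡⟨ cong₂ _+_ length-codes length-codes ⟩
    (1 + (suc m + suc m)) + (1 + (suc m + suc m))
      ≡⟨ identity m ⟩
    6 + 4 * m ∎
    where
    open ≡-Reasoning
    identity : ∀ m → (1 + (suc m + suc m)) + (1 + (suc m + suc m)) ≡ 6 + 4 * m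
    identity = solve-∀

  ∈codewords⇒coded : w ∈ codewords → Coded w
  ∈codewords⇒coded w∈ with ∈-cartesianProductWith⁻ codeword (𝟎 ∷ 𝟏 ∷ []) codes w∈
  ... | c , k , _ , k∈ , w≡ = c , k , ∈codes⇒valid k∈ , w≡

  coded⇒∈codewords : Coded w → w ∈ codewords
  coded⇒∈codewords (c , k , valid , refl) =
    ∈-cartesianProductWith⁺ codeword (bit∈ c) (valid⇒∈codes valid)
    where
    bit∈ : ∀ c → c ∈ 𝟎 ∷ 𝟏 ∷ []
    bit∈ 𝟎 = here refl
    bit∈ 𝟏 = there (here refl)

  -- Agreement with the listed words.

  2i∸1≡odd : ∀ i → 2 * suc i ∸ 1 ≡ odd i
  2i∸1≡odd i = trans (+-suc i (i + 0)) (cong (λ z → suc (i + z)) (+-identityʳ i))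

  -- For `i ≤ m`, `n` splits as `4 * suc i` plus twice `suc (gap i)`, so the subtraction does not
  -- truncate.
  middle≡ : ∀ {i} → i ≤ m → (n ∸ 4 * suc i) + 1 ≡ odd (suc (gap i))
  middle≡ {i} i≤m = begin
    (n ∸ 4 * suc i) + 1 ≡⟨ cong (λ z → (6 + 2 * z ∸ 4 * suc i) + 1) (2i+gap i≤m) ⟨
    (6 + 2 * (2 * i + gap i) ∸ 4 * suc i) + 1
      ≡⟨ cong (λ z → (z ∸ 4 * suc i) + 1) (split i (gap i)) ⟩
    (4 * suc i + (suc (gap i) + suc (gap i)) ∸ 4 * suc i) + 1
      ≡⟨ cong (_+ 1) (m+n∸m≡n (4 * suc i) _) ⟩
    suc (gap i) + suc (gap i) + 1 ≡⟨ +-comm _ 1 ⟩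
    odd (suc (gap i)) ∎
    where
    open ≡-Reasoning
    split : ∀ i j → 6 + 2 * (2 * i + j) ≡ 4 * suc i + (suc j + suc j)
    split = solve-∀

  word₁≡ : ∀ {i} → i ≤ m → word₁ n (suc i) ≡ codeword 𝟎 (rising i)
  word₁≡ {i} i≤m =
    cong₂ (λ a b → 𝟎 ^ a ++ 𝟏 ^ b ++ 𝟎 ^ a ++ 𝟏 ∷ []) (2i∸1≡odd i) (middle≡ i≤m)

  word₂≡ : ∀ {i} → i ≤ m → word₂ n (suc i) ≡ codeword 𝟎 (falling i)
  word₂≡ {i} i≤m = trans
    (cong₂ (λ a b → 𝟎 ∷ 𝟏 ^ a ++ 𝟎 ^ b ++ 𝟏 ^ a) (2i∸1≡odd i) (middle≡ i≤m))
    (cong (λ z → 𝟎 ∷ 𝟏 ^ odd i ++ 𝟎 ^ odd (suc (gap i)) ++ z) (sym (++-identityʳ _)))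

  word₃≡ : word₃ n ≡ codeword 𝟎 hill
  word₃≡ = cong (λ z → 𝟎 ∷ 𝟏 ^ z ++ 𝟎 ∷ []) (identity (2 * m + r))
    where
    identity : ∀ z → 4 + 2 * z ≡ suc (suc z) + suc (suc z)
    identity = solve-∀

  listed⇒valid : Listed n (suc m) w → ∃[ k ] (Valid k × w ≡ codeword 𝟎 k)
  listed⇒valid (inj₁ (suc i , _ , s≤s i≤m , w≡)) =
    rising i , rising i≤m , trans w≡ (word₁≡ i≤m)
  listed⇒valid (inj₂ (inj₁ (suc i , _ , s≤s i≤m , w≡))) =
    falling i , falling i≤m , trans w≡ (word₂≡ i≤m)
  listed⇒valid (inj₂ (inj₂ w≡)) = hill , hill , trans w≡ word₃≡

  valid⇒listed : ∀ {k} → Valid k → Listed n (suc m) (codeword 𝟎 k)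
  valid⇒listed (rising {i} i≤m)  = inj₁ (suc i , s≤s z≤n , s≤s i≤m , sym (word₁≡ i≤m))
  valid⇒listed (falling {i} i≤m) = inj₂ (inj₁ (suc i , s≤s z≤n , s≤s i≤m , sym (word₂≡ i≤m)))
  valid⇒listed hill              = inj₂ (inj₂ (sym word₃≡))

  -- Every listed word begins with `𝟎`; the codewords beginning with `𝟏` are the complements.
  coded⇒listed : Coded w → WithComplements (Listed n (suc m)) w
  coded⇒listed (𝟎 , k , valid , refl) = inj₁ (valid⇒listed valid)
  coded⇒listed (𝟏 , k , valid , refl) =
    inj₂ (_ , valid⇒listed valid , sym (complement-runs 𝟎 𝟏 (familyRuns (family-of k))))

  listed⇒coded : WithComplements (Listed n (suc m)) w → Coded w
  listed⇒coded (inj₁ w-listed) = 𝟎 , listed⇒valid w-listed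
  listed⇒coded (inj₂ (v , v-listed , refl)) with listed⇒valid v-listed
  ... | k , valid , refl = 𝟏 , k , valid , complement-runs 𝟎 𝟏 (familyRuns (family-of k))

-- The two residue classes modulo four.

Enumerated : (n count bound : ℕ) → Set
Enumerated n count bound =
  HasExactly count (MinimalForbiddenOfLength n)
  × (∀ w → MinimalForbiddenOfLength n w ⇔ WithComplements (Listed n bound) w)

enumerated : ∀ m r → r ≤ 1 → 8 ≤ 6 + 2 * (2 * m + r) →
  Enumerated (6 + 2 * (2 * m + r)) (6 + 4 * m) (suc m)
enumerated m r r≤1 8≤n =
  (codewords , length-codewords , codewords-unique ,
    λ w → mk⇔ (coded⇒minimal ∘ ∈codewords⇒coded) (coded⇒∈codewords ∘ minimal⇒coded 8≤n)) ,
  λ w → mk⇔ (coded⇒listed ∘ minimal⇒coded 8≤n) (coded⇒minimal ∘ listed⇒coded)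
  where open Enumeration m r r≤1

-- The bound on `n` leaves `q ≡ suc (suc m)`, hence `n ≡ 8 + 4 * m`, the case where `r` is one.
enumerated-4q : ∀ n q → n ≡ q * 4 → 8 ≤ n → Enumerated n (n ∸ 2) (q ∸ 1)
enumerated-4q _ 1             refl (s≤s (s≤s (s≤s (s≤s ()))))
enumerated-4q _ (suc (suc m)) refl 8≤n = subst₂ (λ n k → Enumerated n k (suc m))
  (length≡ m) (cong (6 +_) (*-comm 4 m))
  (enumerated m 1 ≤-refl (subst (8 ≤_) (sym (length≡ m)) 8≤n))
  where
  length≡ : ∀ m → 6 + 2 * (2 * m + 1) ≡ suc (suc m) * 4
  length≡ = solve-∀

enumerated-2+4q : ∀ n q → n ≡ 2 + q * 4 → 8 ≤ n → Enumerated n n q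
enumerated-2+4q _ zero    refl (s≤s (s≤s ()))
enumerated-2+4q _ (suc m) refl 8≤n = subst₂ (λ n k → Enumerated n k (suc m))
  (length≡ m) (cong (6 +_) (*-comm 4 m))
  (enumerated m 0 z≤n (subst (8 ≤_) (sym (length≡ m)) 8≤n))
  where
  length≡ : ∀ m → 6 + 2 * (2 * m + 0) ≡ 2 + suc m * 4
  length≡ = solve-∀

theorem4 : (∀ (n : ℕ) → n % 4 ≡ 0 → 8 ≤ n →
    HasExactly (n ∸ 2) (MinimalForbiddenOfLength n)
    × (∀ (w : Word) → MinimalForbiddenOfLength n w
    ⇔ WithComplements (Listed n (n / 4 ∸ 1)) w))
    × (∀ (n : ℕ) → n % 4 ≡ 2 → 10 ≤ n →
    HasExactly n (MinimalForbiddenOfLength n)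
    × (∀ (w : Word) → MinimalForbiddenOfLength n w
    ⇔ WithComplements (Listed n ((n ∸ 2) / 4)) w))
theorem4 =
  (λ n n%4≡0 8≤n → enumerated-4q n (n / 4) (quotient n n%4≡0) 8≤n) ,
  (λ n n%4≡2 10≤n → enumerated-2+4q n ((n ∸ 2) / 4) (quotient∸2 n n%4≡2)
     (≤-trans (m≤n+m 8 2) 10≤n))
  where
  quotient : ∀ n {r} → n % 4 ≡ r → n ≡ r + n / 4 * 4
  quotient n n%4≡r = trans (m≡m%n+[m/n]*n n 4) (cong (_+ n / 4 * 4) n%4≡r)
  quotient∸2 : ∀ n → n % 4 ≡ 2 → n ≡ 2 + (n ∸ 2) / 4 * 4
  quotient∸2 n n%4≡2 = begin
    n                     ≡⟨ n≡ ⟩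
    -- After subtracting the remainder two, a multiple of four is left, with the same quotient as
    -- `n`.
    2 + n / 4 * 4         ≡⟨ cong (λ k → 2 + k * 4) (m*n/n≡m (n / 4) 4) ⟨
    2 + n / 4 * 4 / 4 * 4 ≡⟨ cong (λ k → 2 + (k ∸ 2) / 4 * 4) n≡ ⟨
    2 + (n ∸ 2) / 4 * 4   ∎
    where
    open ≡-Reasoning
    n≡ : n ≡ 2 + n / 4 * 4
    n≡ = quotient n n%4≡2
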